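{- Let $k\geqslant3$ and $1\leqslant d\leqslant k-1$ with $k-d\geqslant d$. For all $n\geqslant k$ and $1\leqslant m\leqslant k-d$, $$A(n,m)=\sum_{i=0}^{m+d}(-1)^i\binom{m+d-i}{i}f_{n-i}.$$
   Context: A permutation $\pi\in\mathfrak S_n$ avoids a pattern $\tau\in\mathfrak S_k$ if no subsequence of $\pi$ of length $k$ is order-isomorphic to $\tau$. For $a,b\geqslant1$, $w(a,b)=(a,a-1,\dots,1,a+b,a+b-1,\dots,a+1)$. Let $T^{d,k}=\{(1,2,3),w(k-d,d)\}$ and let $f_n$ be the number of permutations in $\mathfrak S_n$ avoiding both patterns of $T^{d,k}$ ($f_0=1$). For $n\geqslant1$, $1\leqslant m\leqslant n$ and $i_1,\dots,i_m\in\{1,\dots,n\}$, $g_n(i_1,\dots,i_m)$ is the number of such avoiding permutations $\pi\in\mathfrak S_n$ with $\pi_j=i_j$ for $j=1,\dots,m$. For positive integers $n,m$, let $\mathcal I(n,m)$ be the set of integer tuples $(i_1,\dots,i_m)$ with $m-j\leqslant i_{j+1}\leqslant i_j-1$ for $j=0,\dots,m-1$, where $i_0:=n-d+1$ (i.e. $n-d\geqslant i_1>\dots>i_m\geqslant1$), and $A(n,m)=\sum_{(i_1,\dots,i_m)\in\mathcal I(n,m)}g_n(i_1,\dots,i_m)$. -}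

module Defs where

open import Data.Bool using (Bool; true; false; not; _∧_; if_then_else_)
open import Data.Bool.Properties using () renaming (_≟_ to _≟𝔹_)
open import Data.Nat using (ℕ; zero; suc; _+_; _∸_; _≡ᵇ_; _<ᵇ_; _≤ᵇ_)
open import Data.Nat.Combinatorics using (_C_)
open import Data.List using (List; []; _∷_; _++_; map; concatMap; length; filterᵇ; upTo; reverse; take)
open import Data.Bool.ListAction using (any; all)
open import Data.List.Properties using (≡-dec)
open import Data.Integer as ℤ using (ℤ)
open import Relation.Nullary.Decidable using (⌊_⌋)

-- A permutation of [n] = {1..n} is represented in one-line notation as a list of naturals.

range : ℕ → List ℕ
range n = map suc (upTo n)

words : ℕ → ℕ → List (List ℕ)
words n zero    = [] ∷ []
words n (suc l) = concatMap (λ x → map (x ∷_) (words n l)) (range n)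

distinctᵇ : List ℕ → Bool
distinctᵇ []       = true
distinctᵇ (x ∷ xs) = not (any (x ≡ᵇ_) xs) ∧ distinctᵇ xs

perms : ℕ → List (List ℕ)
perms n = filterᵇ distinctᵇ (words n n)

subseqs : ℕ → List ℕ → List (List ℕ)
subseqs zero    xs       = [] ∷ []
subseqs (suc k) []       = []
subseqs (suc k) (x ∷ xs) = map (x ∷_) (subseqs k xs) ++ subseqs (suc k) xs

cmpMat : List ℕ → List (List Bool)
cmpMat xs = map (λ x → map (x <ᵇ_) xs) xs

orderIsoᵇ : List ℕ → List ℕ → Bool
orderIsoᵇ σ τ = ⌊ ≡-dec (≡-dec _≟𝔹_) (cmpMat σ) (cmpMat τ) ⌋

containsᵇ : List ℕ → List ℕ → Bool
containsᵇ τ π = any (λ σ → orderIsoᵇ σ τ) (subseqs (length τ) π)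

avoidsᵇ : List ℕ → List ℕ → Bool
avoidsᵇ τ π = not (containsᵇ τ π)

w : ℕ → ℕ → List ℕ
w a b = reverse (range a) ++ reverse (map (a +_) (range b))

T : ℕ → ℕ → List (List ℕ)
T d k = (1 ∷ 2 ∷ 3 ∷ []) ∷ w (k ∸ d) d ∷ []

avoidsTᵇ : ℕ → ℕ → List ℕ → Bool
avoidsTᵇ d k π = all (λ τ → avoidsᵇ τ π) (T d k)

-- f_n (f_0 = 1 since 𝔖_0 = {ε})
f : ℕ → ℕ → ℕ → ℕ
f d k n = length (filterᵇ (avoidsTᵇ d k) (perms n))

prefixᵇ : List ℕ → List ℕ → Bool
prefixᵇ is π = ⌊ ≡-dec Data.Nat._≟_ (take (length is) π) is ⌋

g : ℕ → ℕ → ℕ → List ℕ → ℕ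
g d k n is = length (filterᵇ (λ π → avoidsTᵇ d k π ∧ prefixᵇ is π) (perms n))

-- condition  m-j ≤ i_{j+1} ≤ i_j - 1  for all j, with `prev` = i_j and `r` = m - j
validIᵇ : ℕ → ℕ → List ℕ → Bool
validIᵇ prev r []       = true
validIᵇ prev r (x ∷ xs) = (r ≤ᵇ x) ∧ (x <ᵇ prev) ∧ validIᵇ x (r ∸ 1) xs

-- 𝓘(n,m), with i_0 = n - d + 1
I : ℕ → ℕ → ℕ → List (List ℕ)
I d n m = filterᵇ (validIᵇ (n ∸ d + 1) m) (words n m)

sumℕ : List ℕ → ℕ
sumℕ = Data.List.foldr _+_ 0

A : ℕ → ℕ → ℕ → ℕ → ℕ
A d k n m = sumℕ (map (g d k n) (I d n m))

sumTo : ℕ → (ℕ → ℤ) → ℤ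
sumTo zero    h = h 0
sumTo (suc N) h = sumTo N h ℤ.+ h (suc N)

RHS : ℕ → ℕ → ℕ → ℕ → ℤ
RHS d k n m = sumTo (m + d) (λ i → (ℤ.- ℤ.1ℤ) ℤ.^ i ℤ.* ℤ.+ ((m + d ∸ i) C i) ℤ.* ℤ.+ (f d k (n ∸ i)))

{-# OPTIONS --safe #-}
module Submission where

open import Defs
open import Data.Nat using (ℕ; _≤_; _∸_)
open import Data.Integer using (+_)
open import Relation.Binary.PropositionalEquality using (_≡_; refl; sym; trans; cong; cong₂; subst; _≢_; setoid; module ≡-Reasoning)
open import Algebra.Bundles using (AbelianGroup)
open import Algebra.Properties.Group using (∙-cancelʳ)
open import Data.Bool using (Bool; true; false; not; _∧_) renaming (T to Tᵇ)
open import Data.Bool.ListAction using (any)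
open import Data.Bool.Properties using (T-∧; T-≡; T?)
open import Data.Integer as ℤ using (ℤ)
import Data.Integer.Properties as ℤ
open import Data.Integer.Tactic.RingSolver using (solve-∀)
open import Data.List using (List; []; _∷_; _++_; map; concatMap; length; filterᵇ; upTo; reverse; take)
open import Data.List.Properties
  using (length-map; length-++; length-upTo; length-reverse; length-take; ∷-injective; ∷-injectiveʳ; map-∘; map-cong; map-injective)
open import Data.List.Membership.Propositional using (_∈_; find; lose)
open import Data.List.Membership.Propositional.Properties
  using (∈-map⁺; ∈-map⁻; ∈-++⁺ˡ; ∈-++⁺ʳ; ∈-++⁻; ∈-∃++;
    ∈-filter⁺; ∈-filter⁻; ∈-concatMap⁺; ∈-concatMap⁻; ∈-upTo⁺; ∈-upTo⁻)
open import Data.List.Relation.Binary.Permutation.Propositional using (_↭_; prep; swap; ↭-refl; ↭-trans; ↭-sym; ↭⇒↭ₛ)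
open import Data.List.Relation.Binary.Permutation.Propositional.Properties using (All-resp-↭; ↭-length)
import Data.List.Relation.Binary.Permutation.Setoid.Properties as Permutationₛ
open import Data.List.Relation.Binary.Pointwise as Pointwise using (Pointwise; []; _∷_)
open import Data.List.Relation.Binary.Sublist.Propositional using (_⊆_; []; _∷_; _∷ʳ_; minimum; ⊆-refl; ⊆-trans; from∈)
open import Data.List.Relation.Binary.Sublist.Propositional.Properties using (All-resp-⊆; ++⁺ˡ) renaming (map⁺ to ⊆-map⁺)
open import Data.List.Relation.Unary.All as All using (All; []; _∷_)
import Data.List.Relation.Unary.All.Properties as All
open import Data.List.Relation.Unary.AllPairs using ([]; _∷_)
open import Data.List.Relation.Unary.Any as Any using (here; there; any?)
open import Data.List.Relation.Unary.Any.Properties using (any⁺; any⁻; reverse⁻)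
open import Data.List.Relation.Unary.Unique.Propositional using (Unique)
import Data.List.Relation.Unary.Unique.Propositional.Properties as Unique
open import Data.Nat using (zero; suc; _+_; _<_; _≡ᵇ_; _<ᵇ_; _≤ᵇ_; z≤n; s≤s; s≤s⁻¹; z<s; s<s; >-nonZero)
open import Data.Nat.Combinatorics using (_C_; nCn≡1; nCk≡nC[n∸k]; nCk+nC[k+1]≡[n+1]C[k+1]; k>n⇒nCk≡0)
open import Data.Nat.Properties
open import Data.Product using (_×_; _,_; ∃; ∃₂; proj₁; proj₂)
open import Data.Sum using (_⊎_; inj₁; inj₂)
open import Function using (_∘_; _⇔_; mk⇔; Injective)
open import Function.Bundles using (Equivalence)
open import Relation.Binary.Definitions using (tri<; tri≈; tri>)
open import Relation.Nullary using (¬_; Dec; yes; no; contradiction)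
open import Relation.Nullary.Decidable using (⌊_⌋; toWitness; fromWitness)

-- Let D n q m count the avoiding permutations π of [n] with q > π₁ > … > πₘ, and let a = k − d.
-- Suppose m ≥ 1 and q ≤ n + 1. If such a π of [n + 1] does not fall further at position m + 1, then avoiding
-- 123 forces πₘ₊₁ = n + 1, and for m < a deleting that entry is a bijection onto the objects of D n q m.
-- If instead π has π₁ = q > π₂ > … > πₘ₊₁ and fewer than d values exceed q, deleting π₁ and closing the gap
-- is also a bijection onto the objects of D n q m. Comparing the two,
-- D (n+1) q m = D (n+1) (q+1) (m+1), so D n (n+1−c) m depends only on p = m + c, and it satisfies the
-- Chebyshev recurrence U (p+2) (n+1) = U (p+1) (n+1) − U p n of the alternating binomial sums.

open Equivalence using (to; from)

private variable
  X Y : Set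

-- Lists and permutations

unique-⊆⇒length-≤ : {xs ys : List X} → Unique xs → (∀ {x} → x ∈ xs → x ∈ ys) → length xs ≤ length ys
unique-⊆⇒length-≤ {xs = []}     _          _   = z≤n
unique-⊆⇒length-≤ {xs = x ∷ xs} (x∉ ∷ uxs) sub
  with ys₁ , ys₂ , refl ← ∈-∃++ (sub (here refl)) = begin
  suc (length xs)                  ≤⟨ s≤s (unique-⊆⇒length-≤ uxs sub′) ⟩
  suc (length (ys₁ ++ ys₂))        ≡⟨ cong suc (length-++ ys₁) ⟩
  suc (length ys₁ + length ys₂)    ≡⟨ +-suc (length ys₁) (length ys₂) ⟨
  length ys₁ + suc (length ys₂)    ≡⟨ length-++ ys₁ ⟨
  length (ys₁ ++ x ∷ ys₂)          ∎
  where
  open ≤-Reasoning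
  sub′ : ∀ {z} → z ∈ xs → z ∈ ys₁ ++ ys₂
  sub′ z∈ with ∈-++⁻ ys₁ (sub (there z∈))
  ... | inj₁ z∈₁           = ∈-++⁺ˡ z∈₁
  ... | inj₂ (here refl)   = contradiction refl (All.lookup x∉ z∈)
  ... | inj₂ (there z∈₂)   = ∈-++⁺ʳ ys₁ z∈₂

-- All counts in the proof are lengths of duplicate-free lists, so comparing two of them reduces to
-- comparing membership.
unique-sameElements⇒length-≡ : {xs ys : List X} → Unique xs → Unique ys → (∀ {x} → x ∈ xs ⇔ x ∈ ys) →
  length xs ≡ length ys
unique-sameElements⇒length-≡ uxs uys same =
  ≤-antisym (unique-⊆⇒length-≤ uxs (to same)) (unique-⊆⇒length-≤ uys (from same))

unique-concatMap : {h : X → List Y} {xs : List X} → Unique xs → (∀ {x} → x ∈ xs → Unique (h x)) →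
  (∀ {x x′ y} → x ∈ xs → x′ ∈ xs → y ∈ h x → y ∈ h x′ → x ≡ x′) → Unique (concatMap h xs)
unique-concatMap             []         _  _   = []
unique-concatMap {h = h} {x ∷ xs} (x∉ ∷ uxs) uh inj =
  Unique.++⁺ (uh (here refl))
    (unique-concatMap uxs (uh ∘ there) (λ p q → inj (there p) (there q)))
    λ (y∈ , y∈′) → let x′ , x′∈ , y∈hx′ = find (∈-concatMap⁻ h {xs = xs} y∈′) in
      All.lookup x∉ x′∈ (inj (here refl) (there x′∈) y∈ y∈hx′)

length-concatMap : (h : X → List Y) (xs : List X) → length (concatMap h xs) ≡ sumℕ (map (length ∘ h) xs)
length-concatMap h []       = refl
length-concatMap h (x ∷ xs) = trans (length-++ (h x)) (cong (_+_ (length (h x))) (length-concatMap h xs))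

count : (X → Bool) → List X → ℕ
count p = length ∘ filterᵇ p

∈-filterᵇ : {p : X → Bool} {xs : List X} {x : X} → x ∈ filterᵇ p xs ⇔ (x ∈ xs × Tᵇ (p x))
∈-filterᵇ {p = p} = mk⇔ (∈-filter⁻ (T? ∘ p)) (λ (x∈ , px) → ∈-filter⁺ (T? ∘ p) x∈ px)

unique-filterᵇ : (p : X → Bool) {xs : List X} → Unique xs → Unique (filterᵇ p xs)
unique-filterᵇ p = Unique.filter⁺ (T? ∘ p)

InRange : ℕ → ℕ → Set
InRange n x = 1 ≤ x × x ≤ n

∈-range : ∀ {n x} → x ∈ range n ⇔ InRange n x
∈-range {n} = mk⇔
  (λ x∈ → let y , y∈ , x≡ = ∈-map⁻ suc x∈ in subst (InRange n) (sym x≡) (z<s , ∈-upTo⁻ y∈))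
  λ { (s≤s _ , x≤n) → ∈-map⁺ suc (∈-upTo⁺ x≤n) }

length-range : ∀ n → length (range n) ≡ n
length-range n = trans (length-map suc (upTo n)) (length-upTo n)

unique-range : ∀ n → Unique (range n)
unique-range n = Unique.map⁺ suc-injective (Unique.upTo⁺ n)

-- Pigeonhole on (l, n], which has n - l elements. It serves to find the maximum in a permutation
-- and to bound the last block of an occurrence of `w a b`.
unique-between⇒length-≤ : ∀ {l n xs} → Unique xs → All (λ x → l < x × x ≤ n) xs → length xs ≤ n ∸ l
unique-between⇒length-≤ {l} {n} {xs} uxs between = begin
  length xs                          ≤⟨ unique-⊆⇒length-≤ uxs (λ x∈ → shifted (All.lookup between x∈)) ⟩
  length (map (_+_ l) (range (n ∸ l))) ≡⟨ length-map (_+_ l) (range (n ∸ l)) ⟩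
  length (range (n ∸ l))             ≡⟨ length-range (n ∸ l) ⟩
  n ∸ l                              ∎
  where
  open ≤-Reasoning
  shifted : ∀ {x} → l < x × x ≤ n → x ∈ map (_+_ l) (range (n ∸ l))
  shifted (l<x , x≤n) = subst (_∈ _) (m+[n∸m]≡n (<⇒≤ l<x))
    (∈-map⁺ (_+_ l) (from ∈-range (m<n⇒0<n∸m l<x , ∸-monoˡ-≤ l x≤n)))

∈-words : ∀ {n l xs} → xs ∈ words n l ⇔ (length xs ≡ l × All (InRange n) xs)
∈-words {n} {l} = mk⇔ (fwd l) (λ (len , rng) → bwd l len rng)
  where
  fwd : ∀ l {xs} → xs ∈ words n l → length xs ≡ l × All (InRange n) xs
  fwd zero    (here refl) = refl , []
  fwd (suc l) xs∈
    with x , x∈ , xs∈′ ← find (∈-concatMap⁻ (λ x → map (x ∷_) (words n l)) {xs = range n} xs∈)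
    with ys , ys∈ , refl ← ∈-map⁻ (x ∷_) xs∈′
    with len , rng ← fwd l ys∈ = cong suc len , to ∈-range x∈ ∷ rng
  bwd : ∀ l {xs} → length xs ≡ l → All (InRange n) xs → xs ∈ words n l
  bwd zero    {[]}     _   _          = here refl
  bwd (suc l) {x ∷ xs} len (rx ∷ rng) = ∈-concatMap⁺ (λ x → map (x ∷_) (words n l))
    (lose (from ∈-range rx) (∈-map⁺ (x ∷_) (bwd l (suc-injective len) rng)))

unique-words : ∀ n l → Unique (words n l)
unique-words n zero    = [] ∷ []
unique-words n (suc l) = unique-concatMap (unique-range n)
  (λ _ → Unique.map⁺ ∷-injectiveʳ (unique-words n l))
  λ {x} {x′} _ _ y∈ y∈′ → let _ , _ , e = ∈-map⁻ (x ∷_) y∈ ; _ , _ , e′ = ∈-map⁻ (x′ ∷_) y∈′ in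
    proj₁ (∷-injective (trans (sym e) e′))

T-distinctᵇ : ∀ {xs} → Tᵇ (distinctᵇ xs) ⇔ Unique xs
T-distinctᵇ {xs} = mk⇔ (fwd xs) (bwd xs)
  where
  fwd : ∀ xs → Tᵇ (distinctᵇ xs) → Unique xs
  fwd []       _ = []
  fwd (x ∷ xs) t with any (x ≡ᵇ_) xs in eq | t
  ... | false | d = All.¬Any⇒All¬ xs (λ x∈ → subst Tᵇ eq (any⁺ (x ≡ᵇ_) (Any.map (λ {y} → ≡⇒≡ᵇ x y) x∈))) ∷ fwd xs d
  bwd : ∀ xs → Unique xs → Tᵇ (distinctᵇ xs)
  bwd []       _         = _
  bwd (x ∷ xs) (x∉ ∷ u) with any (x ≡ᵇ_) xs in eq
  ... | false = bwd xs u
  ... | true  = All.All¬⇒¬Any x∉ (Any.map (λ {y} → ≡ᵇ⇒≡ x y) (any⁻ (x ≡ᵇ_) xs (subst Tᵇ (sym eq) _)))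

record IsPerm (n : ℕ) (π : List ℕ) : Set where
  constructor isPerm
  field
    length≡ : length π ≡ n
    inRange : All (InRange n) π
    unique  : Unique π

open IsPerm

∈-perms : ∀ {n π} → π ∈ perms n ⇔ IsPerm n π
∈-perms = mk⇔
  (λ π∈ → let ws , d = to ∈-filterᵇ π∈ ; len , rng = to ∈-words ws in isPerm len rng (to T-distinctᵇ d))
  (λ (isPerm len rng u) → from ∈-filterᵇ (from ∈-words (len , rng) , from T-distinctᵇ u))

unique-perms : ∀ n → Unique (perms n)
unique-perms n = unique-filterᵇ distinctᵇ (unique-words n n)

-- Pattern containment

Tᵇ-not : ∀ {b} → Tᵇ (not b) ⇔ (¬ Tᵇ b)
Tᵇ-not {true}  = mk⇔ (λ ()) (λ ¬t → ¬t _)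
Tᵇ-not {false} = mk⇔ (λ _ ()) (λ _ → _)

<⇒<ᵇ≡true : ∀ {x y} → x < y → (x <ᵇ y) ≡ true
<⇒<ᵇ≡true = to T-≡ ∘ <⇒<ᵇ

≤⇒<ᵇ≡false : ∀ {x y} → y ≤ x → (x <ᵇ y) ≡ false
≤⇒<ᵇ≡false {x} {y} y≤x with x <ᵇ y in eq
... | false = refl
... | true  = contradiction (<ᵇ⇒< x y (from T-≡ eq)) (≤⇒≯ y≤x)

<ᵇ≡true⇒< : ∀ {x y} → (x <ᵇ y) ≡ true → x < y
<ᵇ≡true⇒< {x} {y} = <ᵇ⇒< x y ∘ from T-≡

Contains : List ℕ → List ℕ → Set
Contains τ π = ∃ λ σ → σ ⊆ π × cmpMat σ ≡ cmpMat τ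

cmpMat-length : ∀ {σ τ} → cmpMat σ ≡ cmpMat τ → length σ ≡ length τ
cmpMat-length {σ} {τ} e = trans (sym (length-map _ σ)) (trans (cong length e) (length-map _ τ))

∈-subseqs : ∀ {k xs ys} → ys ∈ subseqs k xs ⇔ (ys ⊆ xs × length ys ≡ k)
∈-subseqs {k} {xs} = mk⇔ (fwd k xs) (λ (sub , len) → bwd k sub len)
  where
  fwd : ∀ k xs {ys} → ys ∈ subseqs k xs → ys ⊆ xs × length ys ≡ k
  fwd zero    xs       (here refl) = minimum xs , refl
  fwd (suc k) (x ∷ xs) ys∈ with ∈-++⁻ (map (x ∷_) (subseqs k xs)) ys∈
  ... | inj₁ ys∈ˡ with zs , zs∈ , refl ← ∈-map⁻ (x ∷_) ys∈ˡ =
        let sub , len = fwd k xs zs∈ in refl ∷ sub , cong suc len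
  ... | inj₂ ys∈ʳ = let sub , len = fwd (suc k) xs ys∈ʳ in x ∷ʳ sub , len
  bwd : ∀ k {xs ys} → ys ⊆ xs → length ys ≡ k → ys ∈ subseqs k xs
  bwd zero    {ys = []} _         _    = here refl
  bwd (suc k) (x ∷ʳ sub)      len = ∈-++⁺ʳ (map (x ∷_) (subseqs k _)) (bwd (suc k) sub len)
  bwd (suc k) (refl ∷ sub)    len = ∈-++⁺ˡ (∈-map⁺ (_ ∷_) (bwd k sub (suc-injective len)))

T-containsᵇ : ∀ τ π → Tᵇ (containsᵇ τ π) ⇔ Contains τ π
T-containsᵇ τ π = mk⇔
  (λ t → let σ , σ∈ , iso = find (any⁻ (λ σ → orderIsoᵇ σ τ) (subseqs (length τ) π) t) in
    σ , proj₁ (to (∈-subseqs {length τ}) σ∈) , toWitness iso)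
  (λ (σ , σ⊆π , iso) → any⁺ (λ σ → orderIsoᵇ σ τ)
    (lose (from ∈-subseqs (σ⊆π , cmpMat-length iso)) (fromWitness iso)))

cmpMat-map : ∀ {h : ℕ → ℕ} → (∀ x y → (h x <ᵇ h y) ≡ (x <ᵇ y)) → ∀ σ → cmpMat (map h σ) ≡ cmpMat σ
cmpMat-map h-mono σ = trans (sym (map-∘ σ)) (map-cong (λ x → trans (sym (map-∘ σ)) (map-cong (h-mono x) σ)) σ)

SameOrder : List ℕ → List ℕ → ℕ → ℕ → Set
SameOrder σ τ x y = Pointwise (λ x′ y′ → (x <ᵇ x′) ≡ (y <ᵇ y′)) σ τ

-- Equality of comparison matrices is turned into entrywise agreement, so that single comparisons
-- can be read off by position.
cmpMat⇒SameOrder : ∀ {σ τ} → cmpMat σ ≡ cmpMat τ → Pointwise (SameOrder σ τ) σ τ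
cmpMat⇒SameOrder e =
  Pointwise.map (λ {x} {y} row → Pointwise.map⁻ (x <ᵇ_) (y <ᵇ_) (Pointwise.≡⇒Pointwise-≡ row))
    (Pointwise.map⁻ _ _ (Pointwise.≡⇒Pointwise-≡ e))

HasAscent₃ : List ℕ → Set
HasAscent₃ π = ∃ λ x → ∃₂ λ y z → x ∷ y ∷ z ∷ [] ⊆ π × x < y × y < z

Contains-123 : ∀ π → Contains (1 ∷ 2 ∷ 3 ∷ []) π ⇔ HasAscent₃ π
Contains-123 π = mk⇔ fwd bwd
  where
  fwd : Contains (1 ∷ 2 ∷ 3 ∷ []) π → HasAscent₃ π
  fwd (σ , σ⊆π , iso) with cmpMat⇒SameOrder {σ} {1 ∷ 2 ∷ 3 ∷ []} iso
  ... | _∷_ {x} (_ ∷ x<y ∷ _) (_∷_ {y} (_ ∷ _ ∷ y<z ∷ []) (_∷_ {z} _ [])) = x , y , z , σ⊆π , <ᵇ≡true⇒< {x} {y} x<y , <ᵇ≡true⇒< {y} {z} y<z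
  bwd : HasAscent₃ π → Contains (1 ∷ 2 ∷ 3 ∷ []) π
  bwd (x , y , z , sub , x<y , y<z) = x ∷ y ∷ z ∷ [] , sub , iso
    where
    iso : cmpMat (x ∷ y ∷ z ∷ []) ≡ cmpMat (1 ∷ 2 ∷ 3 ∷ [])
    iso rewrite ≤⇒<ᵇ≡false (≤-refl {x}) | ≤⇒<ᵇ≡false (≤-refl {y}) | ≤⇒<ᵇ≡false (≤-refl {z})
              | <⇒<ᵇ≡true x<y | <⇒<ᵇ≡true y<z | <⇒<ᵇ≡true (<-trans x<y y<z)
              | ≤⇒<ᵇ≡false (<⇒≤ x<y) | ≤⇒<ᵇ≡false (<⇒≤ y<z) | ≤⇒<ᵇ≡false (<⇒≤ (<-trans x<y y<z)) = refl

module _ {R : X → Y → Set} where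

  Pointwise-++⁻ : ∀ {xs} ys₁ {ys₂} → Pointwise R xs (ys₁ ++ ys₂) →
    ∃₂ λ xs₁ xs₂ → xs ≡ xs₁ ++ xs₂ × Pointwise R xs₁ ys₁ × Pointwise R xs₂ ys₂
  Pointwise-++⁻ []        rs       = [] , _ , refl , [] , rs
  Pointwise-++⁻ (y ∷ ys₁) (r ∷ rs) =
    let _ , _ , e , rs₁ , rs₂ = Pointwise-++⁻ ys₁ rs in _ , _ , cong (_ ∷_) e , r ∷ rs₁ , rs₂

  Pointwise-++⁻ʳ : ∀ xs₁ {xs₂} ys₁ {ys₂} → length xs₁ ≡ length ys₁ →
    Pointwise R (xs₁ ++ xs₂) (ys₁ ++ ys₂) → Pointwise R xs₂ ys₂
  Pointwise-++⁻ʳ []        []        _   rs       = rs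
  Pointwise-++⁻ʳ (_ ∷ xs₁) (_ ∷ ys₁) len (_ ∷ rs) = Pointwise-++⁻ʳ xs₁ ys₁ (suc-injective len) rs

  All-transfer : {P : X → Set} {Q : Y → Set} → (∀ {x y} → R x y → Q y → P x) →
    ∀ {xs ys} → Pointwise R xs ys → All Q ys → All P xs
  All-transfer f []       []       = []
  All-transfer f (r ∷ rs) (q ∷ qs) = f r q ∷ All-transfer f rs qs

length-reverse-range : ∀ n → length (reverse (range n)) ≡ n
length-reverse-range n = trans (length-reverse (range n)) (length-range n)

-- Cutting the comparison matrix after a rows and a columns leaves an off-diagonal block: each of
-- the first a letters lies below each of the last b. Both arguments that exclude an occurrence of
-- `w a b` rest on this block.
w-occurrence : ∀ {a b σ} → cmpMat σ ≡ cmpMat (w a b) →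
  ∃₂ λ u v → σ ≡ u ++ v × length u ≡ a × length v ≡ b × All (λ x → All (x <_) v) u
w-occurrence {a} {b} {σ} iso
  with rows ← cmpMat⇒SameOrder {σ} iso
  with u , v , refl , us , vs ← Pointwise-++⁻ (reverse (range a)) rows =
  u , v , refl , trans |u|≡ (length-reverse-range a) , trans (Pointwise.Pointwise-length vs) |high| ,
  -- The outer transfer runs over the first a rows, the inner one over the last b columns; in
  -- `w a b` the value a separates the two blocks.
  All-transfer (λ {x} row low → All-transfer (λ e → <ᵇ≡true⇒< {x} ∘ trans e ∘ <⇒<ᵇ≡true)
                              (Pointwise-++⁻ʳ u _ |u|≡ row) (All.map (≤-<-trans low) high))
    us low
  where
  |u|≡ = Pointwise.Pointwise-length us
  |high| : length (reverse (map (_+_ a) (range b))) ≡ b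
  |high| = trans (length-reverse (map (_+_ a) (range b))) (trans (length-map (_+_ a) (range b)) (length-range b))
  low : All (_≤ a) (reverse (range a))
  low = All.tabulate (λ x∈ → proj₂ (to ∈-range (reverse⁻ {xs = range a} x∈)))
  high : All (a <_) (reverse (map (_+_ a) (range b)))
  high = All.tabulate λ x∈ → let y , y∈ , x≡ = ∈-map⁻ (_+_ a) (reverse⁻ {xs = map (_+_ a) (range b)} x∈) in
    subst (a <_) (sym x≡) (m<m+n a (proj₁ (to ∈-range y∈)))

record Avoids (a b : ℕ) (π : List ℕ) : Set where
  constructor avoids
  field
    no-123 : ∀ {x y z} → x ∷ y ∷ z ∷ [] ⊆ π → x < y → ¬ y < z
    no-w   : ¬ Contains (w a b) π

T-avoidsᵇ : ∀ τ π → Tᵇ (avoidsᵇ τ π) ⇔ (¬ Contains τ π)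
T-avoidsᵇ τ π = mk⇔
  (λ t → to Tᵇ-not t ∘ from (T-containsᵇ τ π))
  (λ ¬c → from Tᵇ-not (¬c ∘ to (T-containsᵇ τ π)))

T-avoidsTᵇ : ∀ {d k π} → Tᵇ (avoidsTᵇ d k π) ⇔ Avoids (k ∸ d) d π
T-avoidsTᵇ {d} {k} {π} = mk⇔ fwd bwd
  where
  fwd : Tᵇ (avoidsTᵇ d k π) → Avoids (k ∸ d) d π
  fwd t with All.all⁺ (λ τ → avoidsᵇ τ π) (T d k) t
  ... | av₁ ∷ av₂ ∷ [] = avoids
    (λ sub x<y y<z → to (T-avoidsᵇ (1 ∷ 2 ∷ 3 ∷ []) π) av₁ (from (Contains-123 π) (_ , _ , _ , sub , x<y , y<z)))
    (to (T-avoidsᵇ (w (k ∸ d) d) π) av₂)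
  bwd : Avoids (k ∸ d) d π → Tᵇ (avoidsTᵇ d k π)
  bwd (avoids no-123 no-w) = All.all⁻ (λ τ → avoidsᵇ τ π) {xs = T d k}
    ( from (T-avoidsᵇ (1 ∷ 2 ∷ 3 ∷ []) π) (λ c → let _ , _ , _ , sub , x<y , y<z = to (Contains-123 π) c in no-123 sub x<y y<z)
    ∷ from (T-avoidsᵇ (w (k ∸ d) d) π) no-w
    ∷ [])

-- Partitioned counts and falling prefixes

private variable
  m n q v x y : ℕ
  xs ys π σ : List ℕ

-- The members satisfying p are partitioned into those satisfying q and an injective image of the
-- members counted by r. Both recurrences for `D` are instances, with h adding one entry to a
-- permutation.
count-split : {p q : X → Bool} {r : Y → Bool} {xs : List X} {ys : List Y} {h : Y → X} →
  Unique xs → Unique ys → Injective _≡_ _≡_ h →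
  (∀ {x} → x ∈ xs → Tᵇ (q x) → Tᵇ (p x)) →
  (∀ {y} → y ∈ ys → Tᵇ (r y) → h y ∈ xs × Tᵇ (p (h y)) × ¬ Tᵇ (q (h y))) →
  (∀ {x} → x ∈ xs → Tᵇ (p x) → ¬ Tᵇ (q x) → ∃ λ y → y ∈ ys × Tᵇ (r y) × x ≡ h y) →
  count p xs ≡ count q xs + count r ys
count-split {p = p} {q} {r} {xs} {ys} {h} uxs uys h-inj q⇒p h-into h-onto = begin
  length (filterᵇ p xs)                                        ≡⟨ unique-sameElements⇒length-≡
    (unique-filterᵇ p uxs)
    (Unique.++⁺ (unique-filterᵇ q uxs) (Unique.map⁺ h-inj (unique-filterᵇ r uys)) disjoint)
    (mk⇔ fwd bwd) ⟩
  length (filterᵇ q xs ++ map h (filterᵇ r ys))                ≡⟨ length-++ (filterᵇ q xs) ⟩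
  count q xs + length (map h (filterᵇ r ys))                   ≡⟨ cong (_+_ (count q xs)) (length-map h (filterᵇ r ys)) ⟩
  count q xs + count r ys                                      ∎
  where
  open ≡-Reasoning
  disjoint : ∀ {x} → ¬ (x ∈ filterᵇ q xs × x ∈ map h (filterᵇ r ys))
  disjoint (x∈q , x∈r) with y , y∈ , refl ← ∈-map⁻ h x∈r
    with y∈ys , ry ← to ∈-filterᵇ y∈ = proj₂ (proj₂ (h-into y∈ys ry)) (proj₂ (to (∈-filterᵇ {p = q} {xs = xs}) x∈q))
  fwd : ∀ {x} → x ∈ filterᵇ p xs → x ∈ filterᵇ q xs ++ map h (filterᵇ r ys)
  fwd {x} x∈ with x∈xs , px ← to (∈-filterᵇ {p = p}) x∈ with T? (q x)
  ... | yes qx = ∈-++⁺ˡ (from ∈-filterᵇ (x∈xs , qx))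
  ... | no ¬qx with y , y∈ , ry , refl ← h-onto x∈xs px ¬qx =
    ∈-++⁺ʳ (filterᵇ q xs) (∈-map⁺ h (from ∈-filterᵇ (y∈ , ry)))
  bwd : ∀ {x} → x ∈ filterᵇ q xs ++ map h (filterᵇ r ys) → x ∈ filterᵇ p xs
  bwd x∈ with ∈-++⁻ (filterᵇ q xs) x∈
  ... | inj₁ x∈q = let x∈xs , qx = to (∈-filterᵇ {p = q}) x∈q in from ∈-filterᵇ (x∈xs , q⇒p x∈xs qx)
  ... | inj₂ x∈r with y , y∈ , refl ← ∈-map⁻ h x∈r
    with y∈ys , ry ← to (∈-filterᵇ {p = r}) y∈ with hy∈ , phy , _ ← h-into y∈ys ry = from ∈-filterᵇ (hy∈ , phy)

-- The bound q acts as a virtual entry before the list, so the tail of a falling prefix has the same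
-- form; entries past the first m are free.
data Falls : ℕ → ℕ → List ℕ → Set where
  done : Falls q 0 xs
  step : x < q → Falls x m xs → Falls q (suc m) (x ∷ xs)

falls? : ∀ q m xs → Dec (Falls q m xs)
falls? q zero    xs       = yes done
falls? q (suc m) []       = no λ ()
falls? q (suc m) (x ∷ xs) with x <? q | falls? x m xs
... | yes x<q | yes f = yes (step x<q f)
... | no x≮q  | _     = no λ { (step x<q _) → x≮q x<q }
... | _       | no ¬f = no λ { (step _ f) → ¬f f }

Falls-weaken : ∀ {q′} → q ≤ q′ → Falls q m xs → Falls q′ m xs
Falls-weaken q≤q′ done         = done
Falls-weaken q≤q′ (step x<q f) = step (<-≤-trans x<q q≤q′) f

Falls-pred : Falls q (suc m) xs → Falls q m xs
Falls-pred {m = zero}  _            = done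
Falls-pred {m = suc m} (step x<q f) = step x<q (Falls-pred f)

-- Inserting a maximum

insert : ℕ → ℕ → List ℕ → List ℕ
insert zero    v xs       = v ∷ xs
-- Default value: a list shorter than the position takes v at its end, which keeps `insert-↭` and
-- `insert-injective` free of length hypotheses.
insert (suc m) v []       = v ∷ []
insert (suc m) v (x ∷ xs) = x ∷ insert m v xs

insert-↭ : ∀ m v xs → insert m v xs ↭ v ∷ xs
insert-↭ zero    v xs       = ↭-refl
insert-↭ (suc m) v []       = ↭-refl
insert-↭ (suc m) v (x ∷ xs) = ↭-trans (prep x (insert-↭ m v xs)) (swap x v ↭-refl)

insert-injective : ∀ m v → Injective _≡_ _≡_ (insert m v)
insert-injective zero    v                     e = ∷-injectiveʳ e
insert-injective (suc m) v {[]}     {[]}       e = refl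
insert-injective (suc m) v {x ∷ xs} {y ∷ ys}   e = let x≡y , e′ = ∷-injective e in
  cong₂ _∷_ x≡y (insert-injective m v e′)
insert-injective (suc m) v {[]}     {y ∷ ys}   e = contradiction
  (trans (cong length e) (↭-length (insert-↭ (suc m) v (y ∷ ys)))) λ ()
insert-injective (suc m) v {x ∷ xs} {[]}       e = contradiction
  (trans (sym (cong length e)) (↭-length (insert-↭ (suc m) v (x ∷ xs)))) λ ()

⊆-insert : ∀ m v xs → xs ⊆ insert m v xs
⊆-insert zero    v xs       = v ∷ʳ ⊆-refl
⊆-insert (suc m) v []       = minimum _
⊆-insert (suc m) v (x ∷ xs) = refl ∷ ⊆-insert m v xs

Falls-insert⁺ : Falls q m xs → Falls q m (insert m v xs)
Falls-insert⁺ done         = done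
Falls-insert⁺ (step x<q f) = step x<q (Falls-insert⁺ f)

-- In a list shorter than m the default would place v among the first m entries; the length bound
-- makes v stand right after the fall instead.
Falls-insert⁻ : m ≤ length xs → Falls q m (insert m v xs) → Falls q m xs
Falls-insert⁻ {zero}              _         _            = done
Falls-insert⁻ {suc m} {x ∷ xs}    (s≤s m≤)  (step x<q f) = step x<q (Falls-insert⁻ m≤ f)

-- The inserted v is one of the first m + 1 entries, also in the default case. Hence a value v ≥ q
-- stops the fall before length m + 1.
Falls-insert-suc⇒< : ∀ m {v xs} → Falls q (suc m) (insert m v xs) → v < q
Falls-insert-suc⇒< zero             (step v<q _) = v<q
Falls-insert-suc⇒< (suc m) {xs = []}     (step v<q _) = v<q
Falls-insert-suc⇒< (suc m) {xs = x ∷ xs} (step x<q f) = <-trans (Falls-insert-suc⇒< m f) x<q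

-- Letters chosen before v come from the first m entries, which fall from q; so they are at most m
-- in number and fall from q themselves.
⊆-insert⁻ : Falls q m xs → σ ⊆ insert m v xs →
  σ ⊆ xs ⊎ ∃₂ λ σ₁ σ₂ → σ ≡ σ₁ ++ v ∷ σ₂ × length σ₁ ≤ m × Falls q (length σ₁) σ₁
⊆-insert⁻ done         (_ ∷ʳ sub)    = inj₁ sub
⊆-insert⁻ done         (refl ∷ sub)  = inj₂ ([] , _ , refl , z≤n , done)
⊆-insert⁻ (step x<q f) (x ∷ʳ sub) with ⊆-insert⁻ f sub
... | inj₁ sub′                    = inj₁ (x ∷ʳ sub′)
... | inj₂ (σ₁ , σ₂ , e , len , g) = inj₂ (σ₁ , σ₂ , e , m≤n⇒m≤1+n len , Falls-weaken (<⇒≤ x<q) g)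
⊆-insert⁻ (step x<q f) (refl ∷ sub) with ⊆-insert⁻ f sub
... | inj₁ sub′                    = inj₁ (refl ∷ sub′)
... | inj₂ (σ₁ , σ₂ , e , len , g) = inj₂ (_ ∷ σ₁ , σ₂ , cong (_ ∷_) e , s≤s len , step x<q g)

unique-resp-⊆ : ∀ {xs ys : List X} → xs ⊆ ys → Unique ys → Unique xs
unique-resp-⊆ []           []       = []
unique-resp-⊆ (_ ∷ʳ sub)   (_ ∷ u)  = unique-resp-⊆ sub u
unique-resp-⊆ (refl ∷ sub) (x∉ ∷ u) = All-resp-⊆ sub x∉ ∷ unique-resp-⊆ sub u

IsPerm-resp-↭ : xs ↭ ys → IsPerm n xs → IsPerm n ys
IsPerm-resp-↭ p (isPerm len rng u) = isPerm
  (trans (sym (↭-length p)) len) (All-resp-↭ p rng) (Permutationₛ.Unique-resp-↭ (setoid ℕ) (↭⇒↭ₛ p) u)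

-- If n + 1 were missing, n + 1 distinct values would lie in [n].
maximum∈ : IsPerm (suc n) π → suc n ∈ π
maximum∈ {n} {π} (isPerm len rng u) with any? (suc n ≟_) π
... | yes n∈ = n∈
... | no  n∉ = contradiction (subst (_≤ n) len (unique-between⇒length-≤ u between)) 1+n≰n
  where
  between : All (λ x → 0 < x × x ≤ n) π
  between = All.map (λ ((1≤x , x≤1+n) , n≢x) → 1≤x , s≤s⁻¹ (≤∧≢⇒< x≤1+n (n≢x ∘ sym)))
    (All.zip (rng , All.¬Any⇒All¬ π n∉))

IsPerm-cons-maximum : IsPerm (suc n) (suc n ∷ π) ⇔ IsPerm n π
IsPerm-cons-maximum {n} {π} = mk⇔
  (λ { (isPerm len (_ ∷ rng) (n∉ ∷ u)) → isPerm (suc-injective len)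
         (All.map (λ ((1≤x , x≤1+n) , n≢x) → 1≤x , s≤s⁻¹ (≤∧≢⇒< x≤1+n (n≢x ∘ sym))) (All.zip (rng , n∉))) u })
  (λ (isPerm len rng u) → isPerm (cong suc len)
         ((z<s , ≤-refl) ∷ All.map (λ (1≤x , x≤n) → 1≤x , m≤n⇒m≤1+n x≤n) rng)
         (All.map (λ (_ , x≤n) n≡x → <⇒≢ (s≤s x≤n) (sym n≡x)) rng ∷ u))

IsPerm-insert : IsPerm (suc n) (insert m (suc n) π) ⇔ IsPerm n π
IsPerm-insert {n} {m} {π} = mk⇔
  (to IsPerm-cons-maximum ∘ IsPerm-resp-↭ (insert-↭ m (suc n) π))
  (IsPerm-resp-↭ (↭-sym (insert-↭ m (suc n) π)) ∘ from IsPerm-cons-maximum)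

module _ {a b : ℕ} where
  open Avoids

  Avoids-resp-⊆ : σ ⊆ π → Avoids a b π → Avoids a b σ
  Avoids-resp-⊆ σ⊆π (avoids no-123 no-w) = avoids
    (λ sub → no-123 (⊆-trans sub σ⊆π)) (λ (ρ , ρ⊆σ , iso) → no-w (ρ , ⊆-trans ρ⊆σ σ⊆π , iso))

  module _ (1≤b : 1 ≤ b) where

    -- A maximum inserted at position m < a would have to play one of the first a letters of w a b,
    -- none of which is maximal.
    Avoids-insert : m < a → Falls q m π → All (_≤ n) π → Avoids a b π → Avoids a b (insert m (suc n) π)
    Avoids-insert {m} {q} {π} {n} m<a f π≤n av = avoids no-123′ no-w′
      where
      bounded : σ ⊆ insert m (suc n) π → All (_≤ suc n) σ
      bounded sub = All-resp-⊆ sub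
        (All-resp-↭ (↭-sym (insert-↭ m (suc n) π)) (≤-refl ∷ All.map m≤n⇒m≤1+n π≤n))

      no-123′ : ∀ {x y z} → x ∷ y ∷ z ∷ [] ⊆ insert m (suc n) π → x < y → ¬ y < z
      -- The maximum can be neither x nor y, since nothing exceeds it. As z it would be preceded by
      -- x and y from the falling prefix, against x < y.
      no-123′ sub x<y y<z with ⊆-insert⁻ f sub | bounded sub
      ... | inj₁ sub′ | _ = no-123 av sub′ x<y y<z
      ... | inj₂ ([] , _ , refl , _ , _) | _ ∷ y≤ ∷ _ = <⇒≱ x<y y≤
      ... | inj₂ (_ ∷ [] , _ , refl , _ , _) | _ ∷ _ ∷ z≤ ∷ _ = <⇒≱ y<z z≤
      ... | inj₂ (_ ∷ _ ∷ [] , _ , refl , _ , step _ (step y<x _)) | _ = <-asym x<y y<x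
      ... | inj₂ (_ ∷ _ ∷ _ ∷ [] , _ , () , _ , _) | _
      ... | inj₂ (_ ∷ _ ∷ _ ∷ _ ∷ _ , _ , () , _ , _) | _

      no-maximum-before : ∀ u v σ₁ {σ₂} → All (_≤ suc n) v → length σ₁ < length u → 1 ≤ length v →
        All (λ x → All (x <_) v) u → ¬ (u ++ v ≡ σ₁ ++ suc n ∷ σ₂)
      no-maximum-before (x ∷ u) (y ∷ v) []       (y≤ ∷ _) _         _  ((x<y ∷ _) ∷ _) e
        with refl , _ ← ∷-injective e = <⇒≱ x<y y≤
      no-maximum-before (x ∷ u) v       (_ ∷ σ₁) v≤       (s≤s lt)  1≤ (_ ∷ u<v)       e =
        no-maximum-before u v σ₁ v≤ lt 1≤ u<v (∷-injectiveʳ e)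

      no-w′ : ¬ Contains (w a b) (insert m (suc n) π)
      no-w′ (σ , sub , iso) with ⊆-insert⁻ f sub | w-occurrence {a} {b} {σ} iso
      ... | inj₁ sub′ | _ = no-w av (σ , sub′ , iso)
      ... | inj₂ (σ₁ , σ₂ , e , |σ₁|≤m , _) | u , v , refl , |u|≡a , |v|≡b , u<v =
        no-maximum-before u v σ₁ (All.++⁻ʳ u (bounded sub))
          (subst (length σ₁ <_) (sym |u|≡a) (≤-<-trans |σ₁|≤m m<a))
          (subst (1 ≤_) (sym |v|≡b) 1≤b) u<v e

-- An ascent x < z at position m with x < N forces z = N, for otherwise x z N is an increasing subsequence.
ascent⇒insert : ∀ m {N} → (∀ {x y z} → x ∷ y ∷ z ∷ [] ⊆ q ∷ xs → x < y → ¬ y < z) →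
  Unique (q ∷ xs) → All (_≤ N) xs → N ∈ xs → m < length xs → q < N →
  Falls q m xs → ¬ Falls q (suc m) xs → ∃ λ ys → xs ≡ insert m N ys
ascent⇒insert {xs = z ∷ xs} zero {N} no-123 ((q≢z ∷ _) ∷ z∉ ∷ _) (z≤N ∷ _) N∈ _ q<N done ¬f with N∈
... | here refl = xs , refl
... | there N∈xs = contradiction (≤∧≢⇒< z≤N (All.lookup z∉ N∈xs))
  (no-123 (refl ∷ refl ∷ from∈ N∈xs) (≤∧≢⇒< (≮⇒≥ (λ z<q → ¬f (step z<q done))) q≢z))
ascent⇒insert {q} {xs = x ∷ xs} (suc m) {N} no-123 (_ ∷ u) (_ ∷ ≤N) N∈ (s≤s m<) q<N (step x<q f) ¬f with N∈
... | here refl  = contradiction q<N (<⇒≯ x<q)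
... | there N∈xs =
  let ys , e = ascent⇒insert m (no-123 ∘ (q ∷ʳ_)) u ≤N N∈xs m< (<-trans x<q q<N) f (¬f ∘ step x<q)
  in x ∷ ys , cong (x ∷_) e

-- Prepending an entry

-- The order isomorphism from the naturals onto the naturals other than q; on [n] it is the
-- relabelling that makes room for a new entry q.
raise : ℕ → ℕ → ℕ
raise q x with x <? q
... | yes _ = x
... | no  _ = suc x

raise-< : x < q → raise q x ≡ x
raise-< {x} {q} x<q with x <? q
... | yes _   = refl
... | no  x≮q = contradiction x<q x≮q

raise-≥ : q ≤ x → raise q x ≡ suc x
raise-≥ {q} {x} q≤x with x <? q
... | yes x<q = contradiction q≤x (<⇒≱ x<q)
... | no  _   = refl

raise-≢ : ∀ q x → q ≢ raise q x
raise-≢ q x with x <? q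
... | yes x<q = λ { refl → <-irrefl refl x<q }
... | no  x≮q = λ { refl → x≮q ≤-refl }

-- An equation of Booleans says at once that order is preserved and reflected, and is the form in
-- which `cmpMat-map` takes it.
raise-<ᵇ : ∀ q x y → (raise q x <ᵇ raise q y) ≡ (x <ᵇ y)
raise-<ᵇ q x y with x <? q | y <? q
... | yes _   | yes _   = refl
... | no  _   | no  _   = refl
... | yes x<q | no  y≮q = trans (<⇒<ᵇ≡true (m≤n⇒m≤1+n (<-≤-trans x<q (≮⇒≥ y≮q))))
                                (sym (<⇒<ᵇ≡true (<-≤-trans x<q (≮⇒≥ y≮q))))
... | no  x≮q | yes y<q = trans (≤⇒<ᵇ≡false (m≤n⇒m≤1+n (≤-trans (<⇒≤ y<q) (≮⇒≥ x≮q))))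
                                (sym (≤⇒<ᵇ≡false (≤-trans (<⇒≤ y<q) (≮⇒≥ x≮q))))

raise-mono-< : ∀ q → x < y → raise q x < raise q y
raise-mono-< {x} {y} q x<y = <ᵇ≡true⇒< {raise q x} (trans (raise-<ᵇ q x y) (<⇒<ᵇ≡true x<y))

raise-injective : ∀ q → Injective _≡_ _≡_ (raise q)
raise-injective q {x} {y} e with <-cmp x y
... | tri< x<y _ _ = contradiction e (<⇒≢ (raise-mono-< q x<y))
... | tri≈ _ x≡y _ = x≡y
... | tri> _ _ y<x = contradiction (sym e) (<⇒≢ (raise-mono-< q y<x))

raise-onto : q ≢ x → ∃ λ y → x ≡ raise q y
raise-onto {q} {x} q≢x with <-cmp x q
... | tri< x<q _ _ = x , sym (raise-< x<q)
... | tri≈ _ refl _ = contradiction refl q≢x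
-- Above q, the preimage is the predecessor of x.
... | tri> _ _ (s≤s q≤y) = _ , sym (raise-≥ q≤y)

raise-onto-list : All (q ≢_) xs → ∃ λ ys → xs ≡ map (raise q) ys
raise-onto-list []         = [] , refl
raise-onto-list (q≢x ∷ q∉) =
  let y , e = raise-onto q≢x ; ys , e′ = raise-onto-list q∉ in y ∷ ys , cong₂ _∷_ e e′

raise-InRange : InRange (suc n) q → InRange (suc n) (raise q x) ⇔ InRange n x
raise-InRange {n} {q} {x} (1≤q , q≤1+n) with x <? q
... | yes x<q = mk⇔ (λ (1≤x , _) → 1≤x , s≤s⁻¹ (≤-trans x<q q≤1+n)) (λ (1≤x , x≤n) → 1≤x , m≤n⇒m≤1+n x≤n)
... | no  x≮q = mk⇔ (λ (_ , x≤n) → ≤-trans 1≤q (≮⇒≥ x≮q) , s≤s⁻¹ x≤n) (λ (_ , x≤n) → z<s , s≤s x≤n)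

IsPerm-cons-raise : InRange (suc n) q → IsPerm (suc n) (q ∷ map (raise q) π) ⇔ IsPerm n π
IsPerm-cons-raise {n} {q} {π} rq = mk⇔
  (λ { (isPerm len (_ ∷ rng) (_ ∷ u)) → isPerm (trans (sym (length-map (raise q) π)) (suc-injective len))
         (All.map (to (raise-InRange rq)) (All.map⁻ rng)) (Unique.map⁻ u) })
  (λ (isPerm len rng u) → isPerm (cong suc (trans (length-map (raise q) π) len))
         (rq ∷ All.map⁺ (All.map (from (raise-InRange rq)) rng))
         (All.map⁺ (All.tabulate (λ {x} _ → raise-≢ q x)) ∷ Unique.map⁺ (raise-injective q) u))

-- The first m entries lie below p ≤ q, where `raise q` is the identity; an entry at or above q
-- stays too large to take part in the fall.
Falls-raise : ∀ {p} → p ≤ q → Falls p m (map (raise q) xs) ⇔ Falls p m xs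
Falls-raise {q} p≤q = mk⇔ (fwd p≤q) (bwd p≤q)
  where
  fwd : ∀ {p m xs} → p ≤ q → Falls p m (map (raise q) xs) → Falls p m xs
  fwd {xs = []}     _   done        = done
  fwd {xs = x ∷ xs} _   done        = done
  fwd {xs = x ∷ xs} p≤q (step lt f) with x <? q
  ... | yes x<q = step lt (fwd (<⇒≤ x<q) f)
  ... | no  x≮q = contradiction (≤-trans (n≤1+n _) (≤-trans lt p≤q)) x≮q
  bwd : ∀ {p m xs} → p ≤ q → Falls p m xs → Falls p m (map (raise q) xs)
  bwd _   done         = done
  bwd p≤q (step x<p f) rewrite raise-< (<-≤-trans x<p p≤q) = step x<p (bwd (<⇒≤ (<-≤-trans x<p p≤q)) f)

⊆-map⁻ : ∀ {h : X → Y} {xs ys} → ys ⊆ map h xs → ∃ λ zs → zs ⊆ xs × ys ≡ map h zs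
⊆-map⁻ {xs = []}     []           = [] , [] , refl
⊆-map⁻ {xs = x ∷ xs} (_ ∷ʳ sub)   = let zs , zs⊆ , e = ⊆-map⁻ sub in zs , x ∷ʳ zs⊆ , e
⊆-map⁻ {xs = x ∷ xs} (refl ∷ sub) = let zs , zs⊆ , e = ⊆-map⁻ sub in x ∷ zs , refl ∷ zs⊆ , cong (_ ∷_) e

module _ {a b : ℕ} where
  open Avoids

  -- Avoidance depends only on relative order, which `raise q` preserves and reflects.
  Avoids-raise : ∀ q → Avoids a b (map (raise q) π) ⇔ Avoids a b π
  Avoids-raise {π} q = mk⇔
    (λ (avoids no-123 no-w) → avoids
      (λ sub x<y y<z → no-123 (⊆-map⁺ (raise q) sub) (raise-mono-< q x<y) (raise-mono-< q y<z))
      (λ (σ , sub , iso) → no-w (map (raise q) σ , ⊆-map⁺ (raise q) sub , trans (cmpMat-map (raise-<ᵇ q) σ) iso)))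
    (λ (avoids no-123 no-w) → avoids (λ sub → lower no-123 (⊆-map⁻ sub))
      (λ (σ , sub , iso) → lower-w no-w (⊆-map⁻ sub) iso))
    where
    reflect-< : ∀ {x y} → raise q x < raise q y → x < y
    reflect-< {x} {y} lt = <ᵇ≡true⇒< {x} (trans (sym (raise-<ᵇ q x y)) (<⇒<ᵇ≡true lt))
    lower : (∀ {x y z} → x ∷ y ∷ z ∷ [] ⊆ π → x < y → ¬ y < z) →
      ∀ {x y z} → (∃ λ ρ → ρ ⊆ π × x ∷ y ∷ z ∷ [] ≡ map (raise q) ρ) → x < y → ¬ y < z
    lower no-123 (_ ∷ _ ∷ _ ∷ [] , sub , refl) x<y y<z = no-123 sub (reflect-< x<y) (reflect-< y<z)
    lower-w : ¬ Contains (w a b) π → ∀ {σ} → (∃ λ ρ → ρ ⊆ π × σ ≡ map (raise q) ρ) → ¬ (cmpMat σ ≡ cmpMat (w a b))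
    lower-w no-w (ρ , sub , refl) iso = no-w (ρ , sub , trans (sym (cmpMat-map (raise-<ᵇ q) ρ)) iso)

  -- In an occurrence of w a b starting at q, the last b letters lie in (q, n], which is too small;
  -- in an increasing triple starting at q, the smaller first entry of π can replace q.
  Avoids-cons : 1 ≤ a → 1 ≤ b → n < q + b → Falls q 1 π ⊎ q ≡ n →
    Unique (q ∷ π) → All (_≤ n) π → Avoids a b π → Avoids a b (q ∷ π)
  Avoids-cons {n} {q} {π} 1≤a 1≤b n<q+b head uniq π≤n av = avoids (no-123′ head) no-w′
    where
    no-123′ : Falls q 1 π ⊎ q ≡ n → ∀ {x y z} → x ∷ y ∷ z ∷ [] ⊆ q ∷ π → x < y → ¬ y < z
    no-123′ _                        (_ ∷ʳ sub)               x<y y<z = no-123 av sub x<y y<z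
    no-123′ (inj₁ (step p<q done))   (refl ∷ (_ ∷ʳ sub))      x<y y<z = no-123 av (refl ∷ sub) (<-trans p<q x<y) y<z
    no-123′ (inj₁ (step p<q done))   (refl ∷ (refl ∷ _))      x<y _   = <-asym p<q x<y
    -- With q the upper bound of all entries, no later entry can exceed it.
    no-123′ (inj₂ refl)              (refl ∷ sub)             x<y _   with y≤n ∷ _ ← All-resp-⊆ sub π≤n = <⇒≱ x<y y≤n

    no-w′ : ¬ Contains (w a b) (q ∷ π)
    no-w′ (_ , _ ∷ʳ sub , iso) = no-w av (_ , sub , iso)
    no-w′ (q ∷ σ , refl ∷ sub , iso) with w-occurrence {a} {b} {q ∷ σ} iso
    ... | []    , _ , _    , |u|≡a , _ = contradiction (subst (1 ≤_) (sym |u|≡a) 1≤a) λ ()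
    ... | _ ∷ u , v , refl , _ , |v|≡b , q<v ∷ _ = contradiction
      (subst (_≤ n ∸ q) |v|≡b (unique-between⇒length-≤ (unique-resp-⊆ (_ ∷ʳ v⊆) uniq) (All.zip (q<v , All-resp-⊆ v⊆ π≤n))))
      (<⇒≱ (m<n+o⇒m∸n<o n q {{>-nonZero 1≤b}} n<q+b))
      where
      v⊆ : v ⊆ π
      v⊆ = ⊆-trans (++⁺ˡ u ⊆-refl) sub

-- Falling prefixes and the index tuples

Falls-length : Falls q m xs → m ≤ length xs
Falls-length done       = z≤n
Falls-length (step _ f) = s≤s (Falls-length f)

Falls-first : Falls q (suc m) xs → Falls q 1 xs
Falls-first (step x<q _) = step x<q done

-- Below q there must be room for m distinct positive values. This supplies the lower bounds m - j ≤
-- i_{j+1} in the definition of `I`.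
Falls⇒m<q : 1 ≤ q → All (1 ≤_) xs → Falls q m xs → m < q
Falls⇒m<q 1≤q _          done         = 1≤q
Falls⇒m<q _   (1≤x ∷ 1≤) (step x<q f) = <-≤-trans (s<s (Falls⇒m<q 1≤x 1≤ f)) x<q

validI⇒Falls : ∀ π is → Tᵇ (validIᵇ q (length is) is) → take (length is) π ≡ is → Falls q (length is) π
validI⇒Falls π       []       _ _ = done
validI⇒Falls {q} (y ∷ π) (x ∷ is) v e with refl , e′ ← ∷-injective e
  with x<q , v′ ← to (T-∧ {x <ᵇ q}) (proj₂ (to (T-∧ {suc (length is) ≤ᵇ x}) v)) =
  step (<ᵇ⇒< x q x<q) (validI⇒Falls π is v′ e′)

Falls⇒validI : All (1 ≤_) xs → Falls q m xs → Tᵇ (validIᵇ q m (take m xs))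
Falls⇒validI _          done         = _
Falls⇒validI (1≤x ∷ 1≤) (step x<q f) = from T-∧
  (≤⇒≤ᵇ (Falls⇒m<q 1≤x 1≤ f) , from T-∧ (<⇒<ᵇ x<q , Falls⇒validI 1≤ f))

T-prefixᵇ : ∀ is π → Tᵇ (prefixᵇ is π) ⇔ take (length is) π ≡ is
T-prefixᵇ is π = mk⇔ toWitness fromWitness

-- Recurrences for the counts

module _ (d k : ℕ) where

  fallingᵇ : ℕ → ℕ → List ℕ → Bool
  fallingᵇ q m π = avoidsTᵇ d k π ∧ ⌊ falls? q m π ⌋

  D : ℕ → ℕ → ℕ → ℕ
  D n q m = count (fallingᵇ q m) (perms n)

  T-fallingᵇ : Tᵇ (fallingᵇ q m π) ⇔ (Avoids (k ∸ d) d π × Falls q m π)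
  T-fallingᵇ {q} {m} {π} = mk⇔
    (λ t → let av , f = to (T-∧ {avoidsTᵇ d k π}) t in to (T-avoidsTᵇ {d} {k}) av , toWitness f)
    (λ (av , f) → from T-∧ (from (T-avoidsTᵇ {d} {k}) av , fromWitness f))

  -- The permutations are split by whether the fall goes on at position m + 1; if not, the maximum n
  -- + 1 stands there and is deleted. The bound q ≤ n + 1 keeps an inserted maximum from prolonging
  -- the fall, and m < k - d keeps it from creating `w (k ∸ d) d`.
  D-insert : 1 ≤ d → q ≤ suc n → 1 ≤ m → m < k ∸ d → m ≤ n → D (suc n) q m ≡ D (suc n) q (suc m) + D n q m
  D-insert {q} {n} {m@(suc m-1)} 1≤d q≤1+n (s≤s _) m<a m≤n = count-split
    (unique-perms (suc n)) (unique-perms n) (insert-injective m (suc n))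
    (λ {π} _ t → let av , f = to (T-fallingᵇ {π = π}) t in from (T-fallingᵇ {π = π}) (av , Falls-pred f))
    (λ {π} π∈ t → let perm = to ∈-perms π∈ ; av , f = to (T-fallingᵇ {π = π}) t in
      from ∈-perms (from IsPerm-insert perm) ,
      from (T-fallingᵇ {π = insert m (suc n) π})
        (Avoids-insert 1≤d m<a f (All.map proj₂ (inRange perm)) av , Falls-insert⁺ f) ,
      λ t′ → <⇒≱ (Falls-insert-suc⇒< m (proj₂ (to (T-fallingᵇ {π = insert m (suc n) π}) t′))) q≤1+n)
    onto
    where
    onto : π ∈ perms (suc n) → Tᵇ (fallingᵇ q m π) → ¬ Tᵇ (fallingᵇ q (suc m) π) →
      ∃ λ ρ → ρ ∈ perms n × Tᵇ (fallingᵇ q m ρ) × π ≡ insert m (suc n) ρ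
    onto {π} π∈ t ¬t with to (∈-perms {suc n}) π∈ | to (T-fallingᵇ {π = π}) t
    onto {x ∷ xs} π∈ t ¬t | perm | av , step x<q f with maximum∈ perm
    ... | here refl = contradiction q≤1+n (<⇒≱ x<q)
    -- The first entry x takes over the role of the bound, so m - 1 falls remain before the ascent.
    ... | there 1+n∈ with ascent⇒insert m-1 (Avoids.no-123 av) (unique perm) (All.map proj₂ (All.tail (inRange perm)))
           1+n∈ (subst (m ≤_) (sym (suc-injective (length≡ perm))) m≤n) (<-≤-trans x<q q≤1+n) f
           (λ f′ → ¬t (from (T-fallingᵇ {π = x ∷ xs}) (av , step x<q f′)))
    ... | ys , refl with perm′ ← to (IsPerm-insert {m = m} {π = x ∷ ys}) perm =
      x ∷ ys , from ∈-perms perm′ ,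
      from (T-fallingᵇ {π = x ∷ ys})
        ( Avoids-resp-⊆ (⊆-insert m (suc n) (x ∷ ys)) av
        , Falls-insert⁻ (subst (m ≤_) (sym (length≡ perm′)) m≤n) (step x<q f)) ,
      refl

  -- The split is by π₁ < q or π₁ = q. Prepending q creates no increasing triple, because either the
  -- next entry is smaller (1 ≤ m) or q is the maximum; it creates no `w (k ∸ d) d`, because fewer
  -- than d values exceed q.
  D-cons : 1 ≤ d → 1 ≤ k ∸ d → InRange (suc n) q → 1 ≤ m ⊎ q ≡ suc n → suc n < q + d →
    D (suc n) (suc q) (suc m) ≡ D (suc n) q (suc m) + D n q m
  D-cons {n} {q} {m} 1≤d 1≤a q∈ m-or-q 1+n<q+d = count-split
    (unique-perms (suc n)) (unique-perms n) (map-injective (raise-injective q) ∘ ∷-injectiveʳ)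
    (λ {π} _ t → let av , f = to (T-fallingᵇ {π = π}) t in
      from (T-fallingᵇ {π = π}) (av , Falls-weaken (n≤1+n q) f))
    (λ {π} π∈ t → let perm = to ∈-perms π∈ ; av , f = to (T-fallingᵇ {π = π}) t
                      perm′ = from (IsPerm-cons-raise q∈) perm in
      from ∈-perms perm′ ,
      from (T-fallingᵇ {π = q ∷ map (raise q) π})
        ( Avoids-cons 1≤a 1≤d 1+n<q+d (head f m-or-q) (unique perm′)
            (All.map proj₂ (All.tail (inRange perm′))) (from (Avoids-raise q) av)
        , step ≤-refl (from (Falls-raise ≤-refl) f)) ,
      λ t′ → falls-self (proj₂ (to (T-fallingᵇ {π = q ∷ map (raise q) π}) t′)))
    onto
    where
    falls-self : ¬ Falls q (suc m) (q ∷ xs)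
    falls-self (step q<q _) = <-irrefl refl q<q
    head : ∀ {m} → Falls q m π → 1 ≤ m ⊎ q ≡ suc n → Falls q 1 (map (raise q) π) ⊎ q ≡ suc n
    head f (inj₁ (s≤s _)) = inj₁ (from (Falls-raise ≤-refl) (Falls-first f))
    head f (inj₂ q≡)      = inj₂ q≡
    onto : π ∈ perms (suc n) → Tᵇ (fallingᵇ (suc q) (suc m) π) → ¬ Tᵇ (fallingᵇ q (suc m) π) →
      ∃ λ ρ → ρ ∈ perms n × Tᵇ (fallingᵇ q m ρ) × π ≡ q ∷ map (raise q) ρ
    onto {π} π∈ t ¬t with to (∈-perms {suc n}) π∈ | to (T-fallingᵇ {π = π}) t
    onto {x ∷ xs} π∈ t ¬t | perm | av , step (s≤s x≤q) f
      -- Falling from q + 1 but not from q forces the first entry to be q.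
      with refl ← ≤∧≮⇒≡ x≤q (λ x<q → ¬t (from (T-fallingᵇ {π = x ∷ xs}) (av , step x<q f)))
      with x∉ ∷ _ ← unique perm
      with ρ , refl ← raise-onto-list x∉ =
      ρ , from ∈-perms (to (IsPerm-cons-raise q∈) perm) ,
      from (T-fallingᵇ {π = ρ})
        (to (Avoids-raise q) (Avoids-resp-⊆ (q ∷ʳ ⊆-refl) av) , to (Falls-raise ≤-refl) f) ,
      refl

  D-all : (∀ {π} → IsPerm n π → Falls q m π) → D n q m ≡ f d k n
  D-all {n} all-fall = unique-sameElements⇒length-≡
    (unique-filterᵇ _ (unique-perms n)) (unique-filterᵇ _ (unique-perms n))
    (λ {π} → mk⇔
      (λ π∈ → let π∈′ , t = to (∈-filterᵇ {xs = perms n}) π∈ ; av , _ = to (T-fallingᵇ {π = π}) t in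
        from ∈-filterᵇ (π∈′ , from (T-avoidsTᵇ {d} {k}) av))
      (λ π∈ → let π∈′ , av = to (∈-filterᵇ {xs = perms n}) π∈ in
        from ∈-filterᵇ (π∈′ , from (T-fallingᵇ {π = π}) (to (T-avoidsTᵇ {d} {k}) av , all-fall (to ∈-perms π∈′)))))

  -- A permutation has only one prefix of length m, so the classes counted by `g` are disjoint;
  -- their union over `I` consists of the avoiding permutations that fall m times from n - d + 1.
  A≡D : ∀ n m → A d k n m ≡ D n (n ∸ d + 1) m
  A≡D n m = trans (sym (length-concatMap withPrefix (I d n m)))
    (unique-sameElements⇒length-≡
      (unique-concatMap (unique-filterᵇ _ (unique-words n m)) (λ {is} _ → unique-filterᵇ _ (unique-perms n)) same-prefix)
      (unique-filterᵇ _ (unique-perms n))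
      (mk⇔ fwd bwd))
    where
    q₀ = n ∸ d + 1
    prefixed : List ℕ → List ℕ → Bool
    prefixed is π = avoidsTᵇ d k π ∧ prefixᵇ is π
    withPrefix : List ℕ → List (List ℕ)
    withPrefix is = filterᵇ (prefixed is) (perms n)
    ∈-I : ∀ {is} → is ∈ I d n m → length is ≡ m × Tᵇ (validIᵇ q₀ m is)
    ∈-I is∈ = let is∈′ , v = to (∈-filterᵇ {xs = words n m}) is∈ in proj₁ (to (∈-words {n} {m}) is∈′) , v
    ∈-withPrefix : ∀ {is π} → is ∈ I d n m → π ∈ withPrefix is →
      π ∈ perms n × Tᵇ (avoidsTᵇ d k π) × take m π ≡ is
    ∈-withPrefix {is} {π} is∈ π∈ = let
      π∈′ , t = to (∈-filterᵇ {p = prefixed is} {xs = perms n}) π∈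
      av , pre = to (T-∧ {avoidsTᵇ d k π}) t
      in π∈′ , av , subst (λ l → take l π ≡ is) (proj₁ (∈-I is∈)) (to (T-prefixᵇ is π) pre)
    same-prefix : ∀ {is is′ π} → is ∈ I d n m → is′ ∈ I d n m → π ∈ withPrefix is → π ∈ withPrefix is′ → is ≡ is′
    same-prefix is∈ is′∈ π∈ π∈′ =
      trans (sym (proj₂ (proj₂ (∈-withPrefix is∈ π∈)))) (proj₂ (proj₂ (∈-withPrefix is′∈ π∈′)))
    fwd : π ∈ concatMap withPrefix (I d n m) → π ∈ filterᵇ (fallingᵇ q₀ m) (perms n)
    fwd {π} π∈ with is , is∈ , π∈is ← find (∈-concatMap⁻ withPrefix {xs = I d n m} π∈)
      with π∈′ , av , e ← ∈-withPrefix is∈ π∈is | refl , v ← ∈-I is∈ =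
      from ∈-filterᵇ (π∈′ , from (T-fallingᵇ {π = π}) (to (T-avoidsTᵇ {d} {k}) av , validI⇒Falls π is v e))
    bwd : π ∈ filterᵇ (fallingᵇ q₀ m) (perms n) → π ∈ concatMap withPrefix (I d n m)
    bwd {π} π∈ with π∈′ , t ← to (∈-filterᵇ {xs = perms n}) π∈ with perm ← to (∈-perms {n}) π∈′
      with av , f ← to (T-fallingᵇ {π = π}) t =
      ∈-concatMap⁺ withPrefix {xs = I d n m} (lose
        (from (∈-filterᵇ {xs = words n m})
          (from ∈-words (|take| , All.take⁺ m (inRange perm)) , Falls⇒validI (All.map proj₁ (inRange perm)) f))
        (from (∈-filterᵇ {p = prefixed (take m π)}) (π∈′ , from T-∧ (from (T-avoidsTᵇ {d} {k}) av
          , from (T-prefixᵇ (take m π) π) (cong (λ l → take l π) |take|)))))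
      where
      |take| : length (take m π) ≡ m
      |take| = trans (length-take m π) (m≤n⇒m⊓n≡m (Falls-length f))

-- Alternating binomial sums

sumTo-suc : ∀ N h → sumTo (suc N) h ≡ h 0 ℤ.+ sumTo N (h ∘ suc)
sumTo-suc zero    h = refl
sumTo-suc (suc N) h = trans (cong (ℤ._+ h (suc (suc N))) (sumTo-suc N h))
  (ℤ.+-assoc (h 0) (sumTo N (h ∘ suc)) (h (suc (suc N))))

sumTo-cong : ∀ N {h h′ : ℕ → ℤ} → (∀ i → i ≤ N → h i ≡ h′ i) → sumTo N h ≡ sumTo N h′
sumTo-cong zero    e = e 0 z≤n
sumTo-cong (suc N) e = cong₂ ℤ._+_ (sumTo-cong N λ i → e i ∘ m≤n⇒m≤1+n) (e (suc N) ≤-refl)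

sumTo-+ : ∀ N (h h′ : ℕ → ℤ) → sumTo N (λ i → h i ℤ.+ h′ i) ≡ sumTo N h ℤ.+ sumTo N h′
sumTo-+ zero    h h′ = refl
sumTo-+ (suc N) h h′ = trans (cong (ℤ._+ (h (suc N) ℤ.+ h′ (suc N))) (sumTo-+ N h h′))
  (interchange (sumTo N h) (sumTo N h′) (h (suc N)) (h′ (suc N)))
  where
  interchange : ∀ a b c d → (a ℤ.+ b) ℤ.+ (c ℤ.+ d) ≡ (a ℤ.+ c) ℤ.+ (b ℤ.+ d)
  interchange = solve-∀

nC0≡1 : ∀ n → n C 0 ≡ 1
nC0≡1 n = trans (nCk≡nC[n∸k] {0} {n} z≤n) (nCn≡1 n)

module _ (φ : ℕ → ℕ) where

  term : ℕ → ℕ → ℕ → ℤ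
  term p n i = (ℤ.- ℤ.1ℤ) ℤ.^ i ℤ.* + ((p ∸ i) C i) ℤ.* + φ (n ∸ i)

  -- The coefficients are those of the Chebyshev polynomial of the second kind, U_p(x/2). With p = m
  -- + d and φ = `f d k` this is `RHS`.
  U : ℕ → ℕ → ℤ
  U p n = sumTo p (term p n)

  U-zero : ∀ n → U 0 n ≡ + φ n
  U-zero n = ℤ.*-identityˡ (+ φ n)

  -- The term i = 1 carries the coefficient C(0, 1) = 0.
  U-one : ∀ n → U 1 n ≡ + φ n
  U-one n = trans (cong₂ ℤ._+_ (ℤ.*-identityˡ (+ φ n)) (ℤ.*-zeroˡ (+ φ (n ∸ 1)))) (ℤ.+-identityʳ (+ φ n))

  -- Pascal's rule splits C(p + 1 - i, i + 1), and the opposite sign cancels the part C(p - i, i).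
  -- The bound i ≤ p makes truncated subtraction exact.
  term-pascal : ∀ p n {i} → i ≤ p →
    term (2 + p) (suc n) (suc i) ℤ.+ term p n i ≡ term (suc p) (suc n) (suc i)
  term-pascal p n {i} i≤p = begin
    s′ ℤ.* + ((suc p ∸ i) C suc i) ℤ.* φₙ ℤ.+ s ℤ.* + c ℤ.* φₙ  ≡⟨ cong (λ z → s′ ℤ.* z ℤ.* φₙ ℤ.+ s ℤ.* + c ℤ.* φₙ) pascal ⟩
    s′ ℤ.* (+ c ℤ.+ + c′) ℤ.* φₙ ℤ.+ s ℤ.* + c ℤ.* φₙ           ≡⟨ cancel s (+ c) (+ c′) φₙ ⟩
    s′ ℤ.* + c′ ℤ.* φₙ                                         ∎
    where
    open ≡-Reasoning
    s = (ℤ.- ℤ.1ℤ) ℤ.^ i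
    s′ = (ℤ.- ℤ.1ℤ) ℤ.* s
    c = (p ∸ i) C i
    c′ = (p ∸ i) C suc i
    φₙ = + φ (n ∸ i)
    pascal : + ((suc p ∸ i) C suc i) ≡ + c ℤ.+ + c′
    pascal = trans (cong +_ (trans (cong (_C suc i) (+-∸-assoc 1 i≤p)) (sym (nCk+nC[k+1]≡[n+1]C[k+1] (p ∸ i) i))))
      (ℤ.pos-+ c c′)
    cancel : ∀ s c c′ φₙ → (ℤ.- ℤ.1ℤ) ℤ.* s ℤ.* (c ℤ.+ c′) ℤ.* φₙ ℤ.+ s ℤ.* c ℤ.* φₙ ≡ (ℤ.- ℤ.1ℤ) ℤ.* s ℤ.* c′ ℤ.* φₙ
    cancel = solve-∀

  -- Term i of `U p n` is paired with term i + 1 of the longer sum, since both involve φ at n - i.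
  U-rec : ∀ p n → U (2 + p) (suc n) ℤ.+ U p n ≡ U (suc p) (suc n)
  U-rec p n = begin
    U (2 + p) (suc n) ℤ.+ U p n
      ≡⟨ cong (ℤ._+ U p n) (sumTo-suc (suc p) (term (2 + p) (suc n))) ⟩
    t₀ ℤ.+ (Σ₂ ℤ.+ last) ℤ.+ U p n
      ≡⟨ cong (λ z → t₀ ℤ.+ (Σ₂ ℤ.+ z) ℤ.+ U p n) last≡0 ⟩
    t₀ ℤ.+ (Σ₂ ℤ.+ ℤ.0ℤ) ℤ.+ U p n
      ≡⟨ regroup t₀ Σ₂ (U p n) ⟩
    t₀ ℤ.+ (Σ₂ ℤ.+ U p n)
      ≡⟨ cong₂ ℤ._+_ first (trans (sym (sumTo-+ p _ _)) (sumTo-cong p λ i → term-pascal p n)) ⟩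
    term (suc p) (suc n) 0 ℤ.+ sumTo p (term (suc p) (suc n) ∘ suc)
      ≡⟨ sumTo-suc p (term (suc p) (suc n)) ⟨
    U (suc p) (suc n) ∎
    where
    open ≡-Reasoning
    t₀ = term (2 + p) (suc n) 0
    Σ₂ = sumTo p (term (2 + p) (suc n) ∘ suc)
    last = term (2 + p) (suc n) (2 + p)
    -- The longer sum has one term too many, at i = p + 2, and its coefficient is C(0, p + 2) = 0.
    last≡0 : last ≡ ℤ.0ℤ
    last≡0 = trans (cong (λ c → (ℤ.- ℤ.1ℤ) ℤ.^ (2 + p) ℤ.* + c ℤ.* φₙ) (k>n⇒nCk≡0 (s≤s (≤-trans (m∸n≤m p p) (n≤1+n p)))))
      (trans (cong (ℤ._* φₙ) (ℤ.*-zeroʳ ((ℤ.- ℤ.1ℤ) ℤ.^ (2 + p)))) (ℤ.*-zeroˡ φₙ))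
      where φₙ = + φ (suc n ∸ (2 + p))
    first : t₀ ≡ term (suc p) (suc n) 0
    first = cong (λ c → ℤ.1ℤ ℤ.* + c ℤ.* + φ (suc n)) (trans (nC0≡1 (2 + p)) (sym (nC0≡1 (suc p))))
    regroup : ∀ a b c → a ℤ.+ (b ℤ.+ ℤ.0ℤ) ℤ.+ c ≡ a ℤ.+ (b ℤ.+ c)
    regroup = solve-∀

  -- This carries a subtraction-free identity of counts to the integers: when x and z follow `U`,
  -- the recurrence and cancellation determine y.
  U-step : ∀ p {n x y z} → x ≡ y + z → + x ≡ U (suc p) (suc n) → + z ≡ U p n → + y ≡ U (2 + p) (suc n)
  U-step p {n} {x} {y} {z} x≡y+z x≡U z≡U = ∙-cancelʳ (AbelianGroup.group ℤ.+-0-abelianGroup) (U p n) (+ y) (U (2 + p) (suc n)) (begin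
    + y ℤ.+ U p n                 ≡⟨ cong (λ i → + y ℤ.+ i) z≡U ⟨
    + y ℤ.+ + z                   ≡⟨ ℤ.pos-+ y z ⟨
    + (y + z)                     ≡⟨ cong +_ x≡y+z ⟨
    + x                           ≡⟨ x≡U ⟩
    U (suc p) (suc n)             ≡⟨ U-rec p n ⟨
    U (2 + p) (suc n) ℤ.+ U p n   ∎)
    where open ≡-Reasoning

-- Evaluation of the counts by induction

module _ (d k : ℕ) (1≤d : 1 ≤ d) (2≤a : 2 ≤ k ∸ d) where

  D-zero : ∀ n q → + D d k n q 0 ≡ U (f d k) 0 n
  D-zero n q = trans (cong +_ (D-all d k {n} {q} (λ _ → done))) (sym (U-zero (f d k) n))

  D-one : ∀ n → + D d k (suc n) (2 + n) 1 ≡ U (f d k) 1 (suc n)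
  D-one n = trans (cong +_ (D-all d k {suc n} first-fall)) (sym (U-one (f d k) (suc n)))
    where
    first-fall : ∀ {π} → IsPerm (suc n) π → Falls (2 + n) 1 π
    first-fall {_ ∷ _} (isPerm _ ((_ , x≤) ∷ _) _) = step (s≤s x≤) done

  -- `D-insert` and `D-cons` have the same right-hand side.
  D-shift : InRange (suc n) q → 1 ≤ m → m < k ∸ d → m ≤ n → suc n < q + d →
    D d k (suc n) q m ≡ D d k (suc n) (suc q) (suc m)
  D-shift (1≤q , q≤) 1≤m m<a m≤n lt = trans (D-insert d k 1≤d q≤ 1≤m m<a m≤n)
    (sym (D-cons d k 1≤d (≤-trans (n≤1+n 1) 2≤a) (1≤q , q≤) (inj₁ 1≤m) lt))

  -- Induction on p, then on c. For m > 0 and c > 0, `D-insert` yields the recurrence. For m = 0 and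
  -- c ≥ 2, `D-shift` trades one unit of c for one unit of m at the same p, which leads to the
  -- former case.
  D≡U : ∀ p {n q} c m → suc m + c ≡ p → suc n ≡ q + c → c ≤ d → suc m ≤ k ∸ d → p ≤ n →
    + D d k n q (suc m) ≡ U (f d k) p n
  D≡U (suc zero) {suc n} {q} zero zero refl e _ _ _
    -- With c = 0 the bound exceeds every value, so all avoiding permutations of [n + 1] are
    -- counted.
    with refl ← trans e (+-identityʳ q) = D-one n
  D≡U (suc (suc p)) {suc n} {q} (suc zero) zero refl e _ _ _
    -- Here the bound is n + 1: discarding the permutations that start with the maximum leaves
    -- f_{n+1} - f_n.
    with refl ← suc-injective (trans e (+-comm q 1)) =
    U-step (f d k) 0 {n} (D-cons d k 1≤d (<⇒≤ 2≤a) (z<s , ≤-refl) (inj₂ refl) (m<m+n (suc n) 1≤d))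
      (D-one n) (D-zero n (suc n))
  D≡U (suc (suc p)) {suc n} {q} (suc (suc c)) zero refl e c≤d _ p≤n = trans
    (cong +_ (D-shift
      (+-cancelʳ-≤ (2 + c) 1 q (subst (3 + c ≤_) e (m≤n⇒m≤1+n p≤n)) ,
       +-cancelʳ-≤ 1 q (suc n) (subst (q + 1 ≤_) (trans (sym e) (+-comm 1 (suc n))) (+-monoʳ-≤ q (s≤s z≤n))))
      ≤-refl 2≤a (≤-trans (s≤s z≤n) (s≤s⁻¹ p≤n)) (subst (_≤ q + d) (sym e) (+-monoʳ-≤ q c≤d))))
    (D≡U (suc (suc p)) (suc c) 1 refl (trans e (+-suc q (suc c))) (<⇒≤ c≤d) 2≤a p≤n)
  D≡U (suc (suc p)) {suc n} {q} zero (suc m) refl e c≤d m<a p≤n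
    with refl ← trans e (+-identityʳ q) = trans
    -- At c = 0 the shift is read backwards, to the bound n + 1 with one fall fewer; there `D-cons`
    -- at q = n + 1 provides the recurrence.
    (cong +_ (sym (D-shift (z<s , ≤-refl) (s≤s z≤n) m<a (s≤s⁻¹ (subst (_≤ suc n) (cong (suc ∘ suc) (+-identityʳ m)) p≤n))
      (m<m+n (suc n) 1≤d))))
    (U-step (f d k) p {n} (D-cons d k 1≤d (<⇒≤ 2≤a) (z<s , ≤-refl) (inj₂ refl) (m<m+n (suc n) 1≤d))
      (D≡U (suc p) zero m refl e z≤n (<⇒≤ m<a) (<⇒≤ p≤n))
      (shorter m refl (<⇒≤ m<a)))
    where
    -- The deleted permutations may have m = 0, where no fall is imposed and the count is f_n.
    shorter : ∀ m → m + 0 ≡ p → suc m ≤ k ∸ d → + D d k n (suc n) m ≡ U (f d k) p n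
    shorter zero    eq _   = subst (λ p → + D d k n (suc n) 0 ≡ U (f d k) p n) eq (D-zero n (suc n))
    shorter (suc m) eq   m<a = D≡U p zero m eq (sym (+-identityʳ (suc n))) z≤n (<⇒≤ m<a) (s≤s⁻¹ (<⇒≤ p≤n))
  D≡U (suc (suc p)) {suc n} {q} (suc c) (suc m) refl e c≤d m<a p≤n =
    U-step (f d k) p {n}
      (D-insert d k 1≤d (subst (q ≤_) (sym e′) (m≤m+n q c)) (s≤s z≤n) m<a
        (≤-trans (m≤m+n (suc m) c) (subst (_≤ n) (+-suc m c) p≤n′)))
      (D≡U (suc p) (suc c) m refl e c≤d (<⇒≤ m<a) (<⇒≤ p≤n))
      (D≡U p c m (sym (+-suc m c)) e′ (<⇒≤ c≤d) (<⇒≤ m<a) p≤n′)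
    where
    e′ : suc n ≡ q + c
    e′ = suc-injective (trans e (+-suc q c))
    p≤n′ : p ≤ n
    p≤n′ = s≤s⁻¹ (<⇒≤ p≤n)

theorem2p5 : (d k : ℕ) → 3 ≤ k → 1 ≤ d → d ≤ k ∸ 1 → d ≤ k ∸ d →
    (n m : ℕ) → k ≤ n → 1 ≤ m → m ≤ k ∸ d →
    + (A d k n m) ≡ RHS d k n m
theorem2p5 d k 3≤k 1≤d d≤k∸1 d≤k∸d n m@(suc m-1) k≤n 1≤m m≤k∸d =
  -- The bound n - d + 1 is n + 1 - c for c = d, whence p = m + d.
  trans (cong +_ (A≡D d k n m)) (D≡U d k 1≤d 2≤k∸d (m + d) d m-1 refl q+d ≤-refl m≤k∸d m+d≤n)
  where
  d≤k : d ≤ k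
  d≤k = ≤-trans d≤k∸1 (m∸n≤m k 1)
  -- From k - d ≤ 1 and d ≤ k - d it would follow that k ≤ 2.
  2≤k∸d : 2 ≤ k ∸ d
  2≤k∸d = ≮⇒≥ λ k∸d<2 → <⇒≱ 3≤k (subst (_≤ 2) (m∸n+n≡m d≤k)
    (+-mono-≤ (s≤s⁻¹ k∸d<2) (≤-trans d≤k∸d (s≤s⁻¹ k∸d<2))))
  m+d≤n : m + d ≤ n
  m+d≤n = ≤-trans (subst (m + d ≤_) (m∸n+n≡m d≤k) (+-monoˡ-≤ d m≤k∸d)) k≤n
  q+d : suc n ≡ n ∸ d + 1 + d
  q+d = sym (trans (cong (_+ d) (+-comm (n ∸ d) 1)) (cong suc (m∸n+n≡m (≤-trans d≤k k≤n))))
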